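{- Let $G$ be a finite simple graph with $V_G=A\cup B$, $E_G=E_{G[A]}\cup E_{G[B]}$, and $A\cap B$ a clique of $G$. Suppose there are MAT-labelings $\lambda_A,\lambda_B,\lambda_{A\cap B}$ of $G[A],G[B],G[A\cap B]$ respectively with $\lambda_A|_{E_{G[A\cap B]}}=\lambda_B|_{E_{G[A\cap B]}}=\lambda_{A\cap B}$. Define $\lambda:E_G\to\mathbb{Z}_{>0}$ by $\lambda(e)=\lambda_A(e)$ if $e\in E_{G[A]}$ and $\lambda(e)=\lambda_B(e)$ if $e\in E_{G[B]}$. Then $\lambda$ is an MAT-labeling of $G$.
   Context: For a simple graph $H$ and $\lambda:E_H\to\mathbb{Z}_{>0}$ put $\pi_k=\lambda^{ -1}(k)$, $E_k=\pi_1\sqcup\dots\sqcup\pi_k$, $E_0=\varnothing$; $\operatorname{cl}(F)$ is the set of edges whose endvertices are joined by a path of edges in $F$; $\lambda$ is an MAT-labeling of $H$ if for all $k\ge1$: (ML1) $\pi_k$ is a forest; (ML2) $\operatorname{cl}(\pi_k)\cap E_{k-1}=\varnothing$; (ML3) each $\{u,u'\}\in\pi_k$ has exactly $k-1$ vertices $w$ with $\{u,w\},\{u',w\}\in E_{k-1}$. $G[X]$ denotes the induced subgraph on $X$; $\lambda$ is well defined since the two labelings agree on $E_{G[A]}\cap E_{G[B]}=E_{G[A\cap B]}$. -}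

module Defs where

open import Data.Nat using (ℕ; _≤_; _∸_)
open import Data.Fin using (Fin)
open import Data.Bool using (Bool; true; false; _∧_; _∨_; T; if_then_else_)
open import Data.Product using (Σ; _×_; ∃)
open import Data.List using (List; _∷_; []; _++_)
open import Data.List.Relation.Unary.Linked using (Linked)
open import Data.List.Relation.Unary.Unique.Propositional using (Unique)
open import Relation.Binary.PropositionalEquality using (_≡_; _≢_)
open import Relation.Binary.Construct.Closure.ReflexiveTransitive using (Star)
open import Relation.Nullary using (¬_)
open import Function.Bundles using (_↔_)

record SimpleGraph (n : ℕ) : Set where
  field
    adj    : Fin n → Fin n → Bool
    sym    : ∀ u v → adj u v ≡ adj v u
    irrefl : ∀ u → adj u u ≡ false
open SimpleGraph public

-- An edge set on vertices Fin n, given by a symmetric Bool-valued relation;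
-- edge {u,v} is present iff T (E u v).
EdgeRel : ℕ → Set
EdgeRel n = Fin n → Fin n → Bool

VSet : ℕ → Set
VSet n = Fin n → Bool

induced : ∀ {n} → SimpleGraph n → VSet n → EdgeRel n
induced G A u v = adj G u v ∧ (A u ∧ A v)

_∩V_ : ∀ {n} → VSet n → VSet n → VSet n
(A ∩V B) v = A v ∧ B v

-- A labeling of the edges by positive integers: a function on pairs that is
-- symmetric and positive on edges (its values off edges are irrelevant).
IsLabeling : ∀ {n} → EdgeRel n → (Fin n → Fin n → ℕ) → Set
IsLabeling E lab = ∀ u v → T (E u v) → (1 ≤ lab u v) × (lab u v ≡ lab v u)

module _ {n : ℕ} (E : EdgeRel n) (lab : Fin n → Fin n → ℕ) where

  π : ℕ → Fin n → Fin n → Set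
  π k u v = T (E u v) × (lab u v ≡ k)

  -- E_k = π_1 ⊔ ... ⊔ π_k
  Eₖ : ℕ → Fin n → Fin n → Set
  Eₖ k u v = T (E u v) × (1 ≤ lab u v) × (lab u v ≤ k)

HasCycle : ∀ {n} → (Fin n → Fin n → Set) → Set
HasCycle {n} F =
  Σ (Fin n) λ x → Σ (Fin n) λ y → Σ (Fin n) λ z → Σ (List (Fin n)) λ zs →
    Unique (x ∷ y ∷ z ∷ zs) × Linked F (x ∷ y ∷ z ∷ zs ++ (x ∷ []))

IsForest : ∀ {n} → (Fin n → Fin n → Set) → Set
IsForest F = ¬ HasCycle F

record IsMATLabeling {n : ℕ} (E : EdgeRel n) (lab : Fin n → Fin n → ℕ) : Set where
  field
    labeling : IsLabeling E lab
    ML1 : ∀ k → 1 ≤ k → IsForest (π E lab k)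
    -- (ML2) cl(π_k) ∩ E_{k-1} = ∅ : no edge of E_{k-1} has its endvertices
    -- joined by a path of edges in π_k
    ML2 : ∀ k → 1 ≤ k → ∀ u v → Star (π E lab k) u v → ¬ Eₖ E lab (k ∸ 1) u v
    ML3 : ∀ k → 1 ≤ k → ∀ u u' → π E lab k u u' →
          Fin (k ∸ 1) ↔ Σ (Fin n) (λ w → Eₖ E lab (k ∸ 1) u w × Eₖ E lab (k ∸ 1) u' w)

glue : ∀ {n} → VSet n → (Fin n → Fin n → ℕ) → (Fin n → Fin n → ℕ) → Fin n → Fin n → ℕ
glue A labA labB u v = if A u ∧ A v then labA u v else labB u v

{-# OPTIONS --safe #-}

-- For an edge e = {u,v} of label k let D(e) be the set of its k-1 common
-- neighbours in E_{k-1}.  The key fact about a single MAT-labeled graph is that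
-- D(e) separates u from v in E_k minus e.  Granted it for labels below k, D(e) is
-- a clique, cliques of E_j have at most j+1 vertices, and two distinct vertices
-- joined to all of D(e) in E_{k-1} lie in different components of E_{k-1} - D(e).
-- In a walk from u to v avoiding e and D(e), every edge f of label k can be
-- bypassed through D(f) unless D(f) = D(e), and what remains collapses to a walk
-- in π_k minus e, which is impossible in a forest.
--
-- For the gluing, ML3 on the three pieces gives D(e) ⊆ A ∩ B whenever
-- e ⊆ A ∩ B.  If a walk in π_k leaves A at x and returns at y, then x and y are
-- equal or joined by an edge e of G[A ∩ B]; its label is not below k by ML2, and
-- not above k since the walk avoids D(e).  So every excursion can be replaced by an
-- edge of label k, and walks of π_k between vertices of A retract to G[A].
module Submission where

open import Defs
open import Data.Nat using (ℕ; zero; suc; _≤_; z≤n; s≤s; _<_)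
open import Data.Nat.Properties using (≤-reflexive; ≤-trans; ≤-irrelevant; m≤n⇒m≤1+n; m≤n⇒m<n∨m≡n; <⇒≱; <⇒≢; <⇒≤; <-cmp; _≤?_)
open import Data.Fin using (Fin)
open import Data.Fin.Properties using (_≟_; any?)
open import Data.Bool using (true; false; _∧_; _∨_; T)
open import Data.Bool.Properties using (T-∧; T-∨; T-irrelevant; T?)
open import Data.Empty using (⊥-elim)
open import Data.Unit using (⊤; tt)
open import Data.Product using (Σ; ∃; _×_; _,_; proj₁; proj₂)
open import Data.Sum using (_⊎_; inj₁; inj₂; [_,_]′; swap)
open import Data.List using (List; []; _∷_; _++_; length; filter; tabulate)
open import Data.List.Properties using (filter-notAll; length-tabulate)
open import Data.List.Membership.Propositional using (_∈_; _∉_; lose)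
open import Data.List.Membership.Propositional.Properties using (∈-filter⁺; ∈-tabulate⁺; ∈-tabulate⁻)
open import Data.List.Relation.Unary.Any using (here; there)
open import Data.List.Relation.Unary.All as All using (All; []; _∷_)
open import Data.List.Relation.Unary.All.Properties using (¬Any⇒All¬)
open import Data.List.Relation.Unary.AllPairs as AllPairs using (AllPairs; []; _∷_)
open import Data.List.Relation.Unary.Linked as Linked using (Linked; [-]; _∷_)
open import Data.List.Relation.Unary.Unique.Propositional using (Unique)
open import Data.List.Relation.Unary.Unique.Propositional.Properties using (tabulate⁺)
open import Data.List.Relation.Binary.Subset.Propositional using (_⊆_)
open import Data.Product.Function.Dependent.Propositional using (Σ-↔)
open import Function using (_∘_; id)
open import Function.Bundles using (_↔_; Inverse; Injection; mk↔ₛ′; Equivalence)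
open import Function.Properties.Inverse using (↔⇒↣)
open import Function.Construct.Composition using (_↔-∘_)
open import Function.Construct.Identity using (↔-id)
open import Relation.Binary.Construct.Closure.ReflexiveTransitive as Star using (Star; ε; _◅_; _◅◅_; kleisliStar)
open import Relation.Binary.Definitions using (Tri; tri<; tri≈; tri>)
open import Relation.Binary.PropositionalEquality using (_≡_; _≢_; refl; trans; cong; cong₂; subst) renaming (sym to ≡-sym)
open import Relation.Nullary using (¬_; Dec; yes; no; contradiction; _×-dec_; _⊎-dec_; ¬?)

-- Duplicate-free lists

module _ {n : ℕ} where

  open import Data.List.Membership.DecPropositional (_≟_ {n}) using (_∈?_)

  Unique-⊆⇒length≤ : ∀ {xs ys : List (Fin n)} → Unique xs → xs ⊆ ys → length xs ≤ length ys
  Unique-⊆⇒length≤ {[]} _ _ = z≤n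
  Unique-⊆⇒length≤ {x ∷ xs} {ys} (x≢xs ∷ uxs) xs⊆ys =
    ≤-trans (s≤s (Unique-⊆⇒length≤ uxs xs⊆ys-x))
            (filter-notAll x≢? ys (lose (xs⊆ys (here refl)) (λ x≢x → x≢x refl)))
    where
    x≢? = λ y → ¬? (x ≟ y)
    xs⊆ys-x : xs ⊆ filter x≢? ys
    xs⊆ys-x y∈xs = ∈-filter⁺ x≢? (xs⊆ys (there y∈xs)) (All.lookup x≢xs y∈xs)

  Unique-⊆⇒⊇ : ∀ {xs ys : List (Fin n)} → Unique xs → xs ⊆ ys → length ys ≤ length xs → ys ⊆ xs
  Unique-⊆⇒⊇ {xs} {ys} uxs xs⊆ys |ys|≤|xs| {y} y∈ys with y ∈? xs
  ... | yes y∈xs = y∈xs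
  ... | no  y∉xs = contradiction |ys|≤|xs|
    (<⇒≱ (Unique-⊆⇒length≤ (¬Any⇒All¬ xs y∉xs ∷ uxs) λ { (here refl) → y∈ys ; (there p) → xs⊆ys p }))

  Unique⇒AllPairs : ∀ {R : Fin n → Fin n → Set} {xs} → Unique xs →
                    (∀ {x y} → x ∈ xs → y ∈ xs → x ≢ y → R x y) → AllPairs R xs
  Unique⇒AllPairs [] _ = []
  Unique⇒AllPairs (x≢xs ∷ uxs) f =
    All.tabulate (λ y∈xs → f (here refl) (there y∈xs) (All.lookup x≢xs y∈xs))
    ∷ Unique⇒AllPairs uxs (λ p q → f (there p) (there q))

  All-⊎ : ∀ {P Q : Fin n → Set} {xs} → All (λ x → P x ⊎ Q x) xs → All P xs ⊎ ∃ λ x → x ∈ xs × Q x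
  All-⊎ [] = inj₁ []
  All-⊎ (inj₂ q ∷ _) = inj₂ (_ , here refl , q)
  All-⊎ (inj₁ p ∷ ps) with All-⊎ ps
  ... | inj₁ ps′ = inj₁ (p ∷ ps′)
  ... | inj₂ (x , x∈ , q) = inj₂ (x , there x∈ , q)

  -- With `Eₖ-split` this distinguishes a clique of E_(m+1) that is already a clique of E_m from one
  -- containing a pair of label m+1.
  AllPairs-⊎ : ∀ {R S : Fin n → Fin n → Set} {xs} → AllPairs (λ x y → R x y ⊎ S x y) xs →
               AllPairs R xs ⊎ ∃ λ x → ∃ λ y → x ∈ xs × y ∈ xs × S x y
  AllPairs-⊎ [] = inj₁ []
  AllPairs-⊎ (p ∷ ps) with All-⊎ p | AllPairs-⊎ ps
  ... | inj₂ (y , y∈ , s) | _ = inj₂ (_ , y , here refl , there y∈ , s)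
  ... | inj₁ _ | inj₂ (x , y , x∈ , y∈ , s) = inj₂ (x , y , there x∈ , there y∈ , s)
  ... | inj₁ r | inj₁ rs = inj₁ (r ∷ rs)

  AllPairs-related : ∀ {R : Fin n → Fin n → Set} → (∀ {x y} → R x y → R y x) →
                     ∀ {xs} → AllPairs R xs → ∀ {x y} → x ∈ xs → y ∈ xs → x ≡ y ⊎ R x y
  AllPairs-related R-sym (_ ∷ _)  (here refl) (here refl) = inj₁ refl
  AllPairs-related R-sym (r ∷ _)  (here refl) (there q)   = inj₂ (All.lookup r q)
  AllPairs-related R-sym (r ∷ _)  (there p)   (here refl) = inj₂ (R-sym (All.lookup r p))
  AllPairs-related R-sym (_ ∷ rs) (there p)   (there q)   = AllPairs-related R-sym rs p q

  -- List form of the bijection in ML3, so that sets of common neighbours can be compared through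
  -- lengths of duplicate-free lists.
  record Enumeration (P : Fin n → Set) (m : ℕ) : Set where
    field
      elements : List (Fin n)
      unique   : Unique elements
      size     : length elements ≡ m
      sound    : ∀ {w} → w ∈ elements → P w
      complete : ∀ {w} → P w → w ∈ elements

  enumerate : ∀ {P : Fin n → Set} {m} → (∀ {w} (p q : P w) → p ≡ q) → Fin m ↔ Σ (Fin n) P → Enumeration P m
  enumerate {P} {m} irr bij = record
    { elements = tabulate (proj₁ ∘ to)
    ; unique   = tabulate⁺ (λ eq → injective (Σ-≡ eq))
    ; size     = length-tabulate _
    ; sound    = λ w∈ → let (i , eq) = ∈-tabulate⁻ w∈ in subst P (≡-sym eq) (proj₂ (to i))
    ; complete = λ {w} p → subst (_∈ _) (cong proj₁ (strictlyInverseˡ (w , p))) (∈-tabulate⁺ (from (w , p)))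
    }
    where
    open Inverse bij using (to; from; strictlyInverseˡ)
    open Injection (↔⇒↣ bij) using (injective)
    -- Irrelevance of `P` carries injectivity on pairs over to the vertices themselves.
    Σ-≡ : {s t : Σ (Fin n) P} → proj₁ s ≡ proj₁ t → s ≡ t
    Σ-≡ {_ , p} {_ , q} refl = cong (_ ,_) (irr p q)

  Enumeration-⊆⇒⊇ : ∀ {P Q : Fin n → Set} {m} → Enumeration P m → Enumeration Q m →
                    (∀ {w} → P w → Q w) → ∀ {w} → Q w → P w
  Enumeration-⊆⇒⊇ ps qs P⇒Q q =
    P.sound (Unique-⊆⇒⊇ P.unique (Q.complete ∘ P⇒Q ∘ P.sound)
                        (≤-reflexive (trans Q.size (≡-sym P.size))) (Q.complete q))
    where
    module P = Enumeration ps
    module Q = Enumeration qs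

-- Walks and cycles

SameEdge : ∀ {n} → (u v x y : Fin n) → Set
SameEdge u v x y = (x ≡ u × y ≡ v) ⊎ (x ≡ v × y ≡ u)

_∖[_,_] : ∀ {n} → (Fin n → Fin n → Set) → Fin n → Fin n → Fin n → Fin n → Set
(F ∖[ u , v ]) x y = F x y × ¬ SameEdge u v x y

_-ᵛ_ : ∀ {n} → (Fin n → Fin n → Set) → (Fin n → Set) → Fin n → Fin n → Set
(F -ᵛ P) x y = F x y × ¬ P x × ¬ P y

module _ {n : ℕ} {R : Fin n → Fin n → Set} where

  open import Data.List.Membership.DecPropositional (_≟_ {n}) using (_∈?_)

  -- The index list omits the starting vertex, so `u ∷ xs` lists all vertices visited.
  data Path : Fin n → List (Fin n) → Fin n → Set where
    []  : ∀ {u} → Path u [] u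
    _∷_ : ∀ {u w v xs} → R u w → Path w xs v → Path u (w ∷ xs) v

  SimplePath : Fin n → Fin n → Set
  SimplePath u v = ∃ λ xs → Path u xs v × Unique (u ∷ xs)

  suffix : ∀ {w xs v u} → Path w xs v → Unique (w ∷ xs) → u ∈ w ∷ xs → SimplePath u v
  suffix p uniq (here refl) = _ , p , uniq
  suffix (_ ∷ p) (_ ∷ uniq) (there u∈) = suffix p uniq u∈

  loopErase : ∀ {u v} → Star R u v → SimplePath u v
  loopErase ε = [] , [] , [] ∷ []
  loopErase {u} (r ◅ rs) with loopErase rs
  ... | xs , p , uniq with u ∈? (_ ∷ xs)
  ...   | yes u∈ = suffix p uniq u∈
  ...   | no  u∉ = _ , r ∷ p , ¬Any⇒All¬ _ u∉ ∷ uniq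

module _ {n : ℕ} {F : Fin n → Fin n → Set} where

  Path⇒Linked : ∀ {R : Fin n → Fin n → Set} → (∀ {x y} → R x y → F x y) →
                ∀ {u xs v t} → Path {R = R} u xs v → F v t → Linked F (u ∷ xs ++ (t ∷ []))
  Path⇒Linked R⇒F [] f = f ∷ [-]
  Path⇒Linked R⇒F (r ∷ p) f = R⇒F r ∷ Path⇒Linked R⇒F p f

  -- After loop erasure, a path without edges would make `F v u` a loop, a single edge would be the
  -- deleted one, and a longer path closes up with `F v u` to a cycle.
  forest⇒¬reconnected : (∀ x → ¬ F x x) → IsForest F →
                        ∀ {u v} → F v u → ¬ Star (F ∖[ u , v ]) u v
  forest⇒¬reconnected irr forest f walk with loopErase walk
  ... | _ , [] , _ = irr _ f
  ... | _ , ((_ , ≁) ∷ []) , _ = ≁ (inj₁ (refl , refl))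
  ... | _ , p@(_ ∷ _ ∷ _) , uniq = forest (_ , _ , _ , _ , uniq , Path⇒Linked proj₁ p f)

  -- Deleting the first edge leaves the path the other way round the cycle. This turns ML1 into a
  -- statement about walks, to which the retraction applies.
  cycle⇒reconnected : HasCycle F → ∃ λ x → ∃ λ y → F x y × Star (F ∖[ y , x ]) y x
  cycle⇒reconnected (x , y , z , zs , ((x≢y ∷ x≢z ∷ x≢zs) ∷ (y≢z∷zs) ∷ _) , (f ∷ g ∷ gs)) =
    x , y , f , (g , [ (λ (_ , z≡x) → x≢z (≡-sym z≡x)) , (λ (y≡x , _) → x≢y (≡-sym y≡x)) ]′)
              ◅ tail z zs (x≢z ∷ x≢zs) y≢z∷zs gs
    where
    -- An edge starting at neither `x` nor `y` is not the deleted one in either orientation.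
    step : ∀ {p q} → x ≢ p → y ≢ p → F p q → (F ∖[ y , x ]) p q
    step x≢p y≢p h = h , [ (λ (p≡y , _) → y≢p (≡-sym p≡y)) , (λ (p≡x , _) → x≢p (≡-sym p≡x)) ]′
    tail : ∀ p ps → All (x ≢_) (p ∷ ps) → All (y ≢_) (p ∷ ps) →
           Linked F (p ∷ ps ++ (x ∷ [])) → Star (F ∖[ y , x ]) p x
    tail p [] (x≢p ∷ _) (y≢p ∷ _) (h ∷ _) = step x≢p y≢p h ◅ ε
    tail p (q ∷ ps) (x≢p ∷ x≢) (y≢p ∷ y≢) (h ∷ hs) = step x≢p y≢p h ◅ tail q ps x≢ y≢ hs

-- Separation in a single MAT-labeled graph

CommonNbr : ∀ {n} → EdgeRel n → (Fin n → Fin n → ℕ) → ℕ → Fin n → Fin n → Fin n → Set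
CommonNbr E lab m u v w = Eₖ E lab m u w × Eₖ E lab m v w

CommonNbr-irrelevant : ∀ {n} (E : EdgeRel n) lab m u v w (p q : CommonNbr E lab m u v w) → p ≡ q
CommonNbr-irrelevant E lab m u v w (a , b) (a′ , b′) = cong₂ _,_ (irr a a′) (irr b b′)
  where
  irr : ∀ {x} (p q : Eₖ E lab m x w) → p ≡ q
  irr (a , b , c) (a′ , b′ , c′) =
    cong₂ _,_ (T-irrelevant a a′) (cong₂ _,_ (≤-irrelevant b b′) (≤-irrelevant c c′))

commonNbrs : ∀ {n} {E : EdgeRel n} {lab} → IsMATLabeling E lab →
             ∀ {m u v} → π E lab (suc m) u v → Enumeration (CommonNbr E lab m u v) m
commonNbrs {E = E} {lab} mat {m} {u} {v} e =
  enumerate (CommonNbr-irrelevant E lab m u v _) (IsMATLabeling.ML3 mat _ (s≤s z≤n) _ _ e)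

module MATGraph {n : ℕ} {E : EdgeRel n} {lab : Fin n → Fin n → ℕ}
                (E-sym : ∀ {u v} → T (E u v) → T (E v u)) (E-irrefl : ∀ {u} → ¬ T (E u u))
                (mat : IsMATLabeling E lab) where

  open IsMATLabeling mat

  lab-sym : ∀ {u v} → T (E u v) → lab v u ≡ lab u v
  lab-sym e = ≡-sym (proj₂ (labeling _ _ e))

  Eₖ-sym : ∀ {m u v} → Eₖ E lab m u v → Eₖ E lab m v u
  Eₖ-sym (e , 1≤ , ≤m) rewrite lab-sym e = E-sym e , 1≤ , ≤m

  Eₖ-irrefl : ∀ {m u} → ¬ Eₖ E lab m u u
  Eₖ-irrefl (e , _) = E-irrefl e

  Eₖ-suc : ∀ {m u v} → Eₖ E lab m u v → Eₖ E lab (suc m) u v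
  Eₖ-suc (e , 1≤ , ≤m) = e , 1≤ , m≤n⇒m≤1+n ≤m

  Eₖ? : ∀ m u v → Dec (Eₖ E lab m u v)
  Eₖ? m u v = T? _ ×-dec (1 ≤? _ ×-dec _ ≤? m)

  E₀-empty : ∀ {u v} → ¬ Eₖ E lab 0 u v
  E₀-empty (_ , 1≤ , ≤0) with ≤-trans 1≤ ≤0
  ... | ()

  π-sym : ∀ {k u v} → π E lab k u v → π E lab k v u
  π-sym (e , eq) = E-sym e , trans (lab-sym e) eq

  π-irrefl : ∀ {k} x → ¬ π E lab k x x
  π-irrefl _ (e , _) = E-irrefl e

  Eₖ-split : ∀ {m u v} → Eₖ E lab (suc m) u v → Eₖ E lab m u v ⊎ π E lab (suc m) u v
  Eₖ-split (e , 1≤ , ≤1+m) with m≤n⇒m<n∨m≡n ≤1+m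
  ... | inj₁ (s≤s ≤m) = inj₁ (e , 1≤ , ≤m)
  ... | inj₂ eq       = inj₂ (e , eq)

  Common : ℕ → Fin n → Fin n → Fin n → Set
  Common = CommonNbr E lab

  Common? : ∀ m u v w → Dec (Common m u v w)
  Common? m u v w = Eₖ? m u w ×-dec Eₖ? m v w

  reconnected-⊥ : ∀ {m u v} → π E lab (suc m) u v → ¬ Star (π E lab (suc m) ∖[ u , v ]) u v
  reconnected-⊥ e = forest⇒¬reconnected π-irrefl (ML1 _ (s≤s z≤n)) (π-sym e)

  ML2′ : ∀ {m u v} → Star (π E lab (suc m)) u v → ¬ Eₖ E lab m u v
  ML2′ = ML2 _ (s≤s z≤n) _ _

  -- The largest label of a triangle is attained only once.
  triangle : ∀ {m a b x} → π E lab (suc m) a b → Eₖ E lab (suc m) a x → Eₖ E lab (suc m) b x →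
             Common m a b x
  triangle {m} {a} {b} {x} ab ax bx with Eₖ-split ax | Eₖ-split bx
  ... | inj₁ ax′ | inj₁ bx′ = ax′ , bx′
  ... | inj₁ ax′ | inj₂ bx′ = contradiction ax′ (ML2′ (ab ◅ bx′ ◅ ε))
  ... | inj₂ ax′ | inj₁ bx′ = contradiction bx′ (ML2′ (π-sym ab ◅ ax′ ◅ ε))
  ... | inj₂ ax′ | inj₂ bx′ = ⊥-elim (reconnected-⊥ ab ((ax′ , ax≁) ◅ (π-sym bx′ , xb≁) ◅ ε))
    where
    ax≁ : ¬ SameEdge a b a x
    ax≁ (inj₁ (_ , refl)) = π-irrefl _ bx′
    ax≁ (inj₂ (_ , refl)) = π-irrefl _ ax′
    xb≁ : ¬ SameEdge a b x b
    xb≁ (inj₁ (refl , _)) = π-irrefl _ ax′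
    xb≁ (inj₂ (refl , _)) = π-irrefl _ bx′

  Clique : ℕ → List (Fin n) → Set
  Clique m = AllPairs (Eₖ E lab m)

  clique⇒unique : ∀ {m xs} → Clique m xs → Unique xs
  clique⇒unique = AllPairs.map λ { xx refl → Eₖ-irrefl xx }

  -- A further vertex forms a triangle with ab, so `triangle` puts it in D(ab). Stated through
  -- adjacency to the two ends, so as to cover `a ∷ b ∷ ds` in `disconnected`, where `a` and `b` may
  -- be nonadjacent.
  clique⊆edge∪common : ∀ {m a b xs} → π E lab (suc m) a b →
                       (∀ {x} → x ∈ xs → x ≡ a ⊎ Eₖ E lab (suc m) a x) →
                       (∀ {x} → x ∈ xs → x ≡ b ⊎ Eₖ E lab (suc m) b x) →
                       (ds : Enumeration (Common m a b) m) →
                       xs ⊆ a ∷ b ∷ Enumeration.elements ds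
  clique⊆edge∪common ab as bs ds x∈ with as x∈ | bs x∈
  ... | inj₁ refl | _         = here refl
  ... | inj₂ _    | inj₁ refl = there (here refl)
  ... | inj₂ ax   | inj₂ bx   = there (there (Enumeration.complete ds (triangle ab ax bx)))

  -- Induction on m: a clique of E_(m+1) with an edge ab of label m+1 lies in {a,b} ∪ D(ab), which
  -- has m+2 vertices; any other is a clique of E_m.
  clique-size : ∀ m {xs} → Clique m xs → length xs ≤ suc m
  clique-size zero [] = z≤n
  clique-size zero ([] ∷ []) = s≤s z≤n
  clique-size zero ((x ∷ _) ∷ _) = contradiction x E₀-empty
  clique-size (suc m) {xs} cl with AllPairs-⊎ (AllPairs.map Eₖ-split cl)
  ... | inj₁ cl′ = m≤n⇒m≤1+n (clique-size m cl′)
  ... | inj₂ (a , b , a∈ , b∈ , ab) =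
    subst (λ l → length xs ≤ suc (suc l)) size
      (Unique-⊆⇒length≤ (clique⇒unique cl) (clique⊆edge∪common ab (adj-to a∈) (adj-to b∈) ds))
    where
    ds = commonNbrs mat ab
    open Enumeration ds using (size)
    adj-to : ∀ {c} → c ∈ xs → ∀ {x} → x ∈ xs → x ≡ c ⊎ Eₖ E lab (suc m) c x
    adj-to c∈ x∈ with AllPairs-related Eₖ-sym cl c∈ x∈
    ... | inj₁ eq = inj₁ (≡-sym eq)
    ... | inj₂ cx = inj₂ cx

  Avoiding : ℕ → Fin n → Fin n → Fin n → Fin n → Set
  Avoiding m u v = (Eₖ E lab (suc m) ∖[ u , v ]) -ᵛ Common m u v

  ¬Commonˡ : ∀ {m u v} → ¬ Common m u v u
  ¬Commonˡ = Eₖ-irrefl ∘ proj₁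

  ¬Commonʳ : ∀ {m u v} → ¬ Common m u v v
  ¬Commonʳ = Eₖ-irrefl ∘ proj₂

  -- One induction on m proves this and the next two statements: `separation m` uses `chord m` and
  -- `disconnected m`, and both of these at m+1 use `separation m`.
  separation : ∀ m {u v} → π E lab (suc m) u v → ¬ Star (Avoiding m u v) u v

  -- If the 4-cycle u, w, v, x lacked both diagonals, going round it from an edge of largest label
  -- would contradict `separation`. This makes D(e) a clique.
  chord : ∀ m {u v w x} → Eₖ E lab m u w → Eₖ E lab m v w → Eₖ E lab m u x → Eₖ E lab m v x →
          ¬ Eₖ E lab m u v → u ≢ v → w ≢ x → Eₖ E lab m w x

  -- A walk contradicts either a count of vertices or `separation` for an edge of top label from
  -- `a`, depending on where the top label occurs.
  disconnected : ∀ m {ds a b} → Clique m ds → length ds ≡ m →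
                 All (Eₖ E lab m a) ds → All (Eₖ E lab m b) ds → a ≢ b →
                 ¬ Star (Eₖ E lab m -ᵛ (_∈ ds)) a b

  -- The detour u, x, v, w avoids D(uw): `x` is outside it unless wx is in E_m, and `v` because uv
  -- is missing.
  chord-max : ∀ m {u v w x} → π E lab (suc m) u w → Eₖ E lab (suc m) v w →
              Eₖ E lab (suc m) u x → Eₖ E lab (suc m) v x →
              ¬ Eₖ E lab (suc m) u v → u ≢ v → w ≢ x → Eₖ E lab (suc m) w x
  chord-max m {u} {v} {w} {x} uw vw ux vx ¬uv u≢v w≢x with Eₖ? m w x
  ... | yes wx = Eₖ-suc wx
  ... | no ¬wx = ⊥-elim (separation m uw
      (  ((ux        , ux≁) , ¬Commonˡ , x∉)
       ◅ ((Eₖ-sym vx , xv≁) , x∉ , v∉)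
       ◅ ((vw        , vw≁) , v∉ , ¬Commonʳ) ◅ ε))
    where
    x∉ : ¬ Common m u w x
    x∉ (_ , wx) = ¬wx wx
    v∉ : ¬ Common m u w v
    v∉ (uv , _) = ¬uv (Eₖ-suc uv)
    ux≁ : ¬ SameEdge u w u x
    ux≁ (inj₁ (_ , refl)) = w≢x refl
    ux≁ (inj₂ (_ , refl)) = Eₖ-irrefl ux
    xv≁ : ¬ SameEdge u w x v
    xv≁ (inj₁ (refl , _)) = Eₖ-irrefl ux
    xv≁ (inj₂ (refl , _)) = w≢x refl
    vw≁ : ¬ SameEdge u w v w
    vw≁ (inj₁ (refl , _)) = u≢v refl
    vw≁ (inj₂ (refl , _)) = Eₖ-irrefl vw

  chord zero uw _ _ _ _ _ _ = contradiction uw E₀-empty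
  chord (suc m) uw vw ux vx ¬uv u≢v w≢x with Eₖ-split uw | Eₖ-split vw | Eₖ-split ux | Eₖ-split vx
  -- Symmetries of the 4-cycle move an edge of label m+1 into the position uw.
  ... | inj₂ uw′ | _ | _ | _ = chord-max m uw′ vw ux vx ¬uv u≢v w≢x
  ... | _ | inj₂ vw′ | _ | _ = chord-max m vw′ uw vx ux (¬uv ∘ Eₖ-sym) (u≢v ∘ ≡-sym) w≢x
  ... | _ | _ | inj₂ ux′ | _ = Eₖ-sym (chord-max m ux′ vx uw vw ¬uv u≢v (w≢x ∘ ≡-sym))
  ... | _ | _ | _ | inj₂ vx′ = Eₖ-sym (chord-max m vx′ ux vw uw (¬uv ∘ Eₖ-sym) (u≢v ∘ ≡-sym) (w≢x ∘ ≡-sym))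
  ... | inj₁ uw′ | inj₁ vw′ | inj₁ ux′ | inj₁ vx′ =
    Eₖ-suc (chord m uw′ vw′ ux′ vx′ (¬uv ∘ Eₖ-suc) u≢v w≢x)

  disconnected zero _ _ _ _ a≢b ε = a≢b refl
  disconnected zero _ _ _ _ _ ((ac , _) ◅ _) = E₀-empty ac
  disconnected (suc m) {ds} {a} {b} cl |ds| a-ds b-ds a≢b walk
    with All-⊎ (All.map Eₖ-split a-ds) | AllPairs-⊎ (AllPairs.map Eₖ-split cl)
  -- `a ∷ ds` would be a clique of E_m with m+2 vertices, one more than `clique-size` allows.
  ... | inj₁ a-ds′ | inj₁ cl′ =
    <⇒≱ (≤-reflexive (cong suc (≡-sym |ds|))) (clique-size m (a-ds′ ∷ cl′))
  -- The m+3 vertices of `a ∷ b ∷ ds` would all lie in {d,e} ∪ D(de), which has m+2.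
  ... | inj₁ _ | inj₂ (d , e , d∈ , e∈ , de) =
    <⇒≱ (≤-reflexive (cong (suc ∘ suc) (trans (cong suc (Enumeration.size fs)) (≡-sym |ds|))))
        (Unique-⊆⇒length≤ unique (clique⊆edge∪common de (adj-to d∈) (adj-to e∈) fs))
    where
    fs = commonNbrs mat de
    ∉ds : ∀ {c} → All (Eₖ E lab (suc m) c) ds → All (c ≢_) ds
    ∉ds = All.map λ { cc refl → Eₖ-irrefl cc }
    unique : Unique (a ∷ b ∷ ds)
    unique = (a≢b ∷ ∉ds a-ds) ∷ ∉ds b-ds ∷ clique⇒unique cl
    adj-to : ∀ {c} → c ∈ ds → ∀ {x} → x ∈ a ∷ b ∷ ds → x ≡ c ⊎ Eₖ E lab (suc m) c x
    adj-to c∈ (here refl) = inj₂ (Eₖ-sym (All.lookup a-ds c∈))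
    adj-to c∈ (there (here refl)) = inj₂ (Eₖ-sym (All.lookup b-ds c∈))
    adj-to c∈ (there (there x∈)) with AllPairs-related Eₖ-sym cl c∈ x∈
    ... | inj₁ eq = inj₁ (≡-sym eq)
    ... | inj₂ cx = inj₂ cx
  -- Here D(a,d) = ds ∖ {d}, and extending the walk by the step from b to d
  -- contradicts separation for the edge ad.
  ... | inj₂ (d , d∈ , ad) | _ =
    separation m ad (Star.map step walk ◅◅ ((All.lookup b-ds d∈ , bd≁) , b∉ds ∘ common⊆ds , ¬Commonʳ) ◅ ε)
    where
    fs = commonNbrs mat ad
    adj-a : ∀ {x} → x ∈ a ∷ ds → x ≡ a ⊎ Eₖ E lab (suc m) a x
    adj-a (here refl) = inj₁ refl
    adj-a (there x∈) = inj₂ (All.lookup a-ds x∈)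
    adj-d : ∀ {x} → x ∈ a ∷ ds → x ≡ d ⊎ Eₖ E lab (suc m) d x
    adj-d (here refl) = inj₂ (Eₖ-sym (All.lookup a-ds d∈))
    adj-d (there x∈) with AllPairs-related Eₖ-sym cl d∈ x∈
    ... | inj₁ eq = inj₁ (≡-sym eq)
    ... | inj₂ dx = inj₂ dx
    K⊆ : a ∷ d ∷ Enumeration.elements fs ⊆ a ∷ ds
    K⊆ = Unique-⊆⇒⊇ (clique⇒unique (a-ds ∷ cl)) (clique⊆edge∪common ad adj-a adj-d fs)
           (≤-reflexive (cong suc (trans (cong suc (Enumeration.size fs)) (≡-sym |ds|))))
    common⊆ds : ∀ {x} → Common m a d x → x ∈ ds
    common⊆ds c with K⊆ (there (there (Enumeration.complete fs c)))
    ... | here refl = contradiction c ¬Commonˡ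
    ... | there x∈ = x∈
    b∉ds : b ∉ ds
    b∉ds b∈ = Eₖ-irrefl (All.lookup b-ds b∈)
    bd≁ : ¬ SameEdge a d b d
    bd≁ (inj₁ (refl , _)) = a≢b refl
    bd≁ (inj₂ (refl , _)) = b∉ds d∈
    step : ∀ {x y} → (Eₖ E lab (suc m) -ᵛ (_∈ ds)) x y → Avoiding m a d x y
    step (xy , x∉ , y∉) =
      (xy , λ { (inj₁ (_ , refl)) → y∉ d∈ ; (inj₂ (refl , _)) → x∉ d∈ }) , x∉ ∘ common⊆ds , y∉ ∘ common⊆ds

  separation m {u} {v} e walk =
    reconnected-⊥ e (collapse (kleisliStar id bypass walk) (All.tabulate (proj₁ ∘ sound)) v-ds ε)
    where
    open Enumeration (commonNbrs mat e)
    ds = elements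

    Complete : Fin n → Set
    Complete c = All (Eₖ E lab m c) ds

    v-ds : Complete v
    v-ds = All.tabulate (proj₂ ∘ sound)

    clique : Clique m ds
    clique = Unique⇒AllPairs unique λ w∈ x∈ →
      chord m (proj₁ (sound w∈)) (proj₂ (sound w∈)) (proj₁ (sound x∈)) (proj₂ (sound x∈))
        (ML2′ (e ◅ ε)) (λ { refl → π-irrefl _ e })

    -- The two kinds of step left after bypassing: low edges avoiding D(e), and top-label edges
    -- whose ends are joined to all of D(e).
    Step : Fin n → Fin n → Set
    Step x y = (Eₖ E lab m -ᵛ (_∈ ds)) x y
             ⊎ ((π E lab (suc m) ∖[ u , v ]) x y × Complete x × Complete y)

    bypass : ∀ {x y} → Avoiding m u v x y → Star Step x y
    bypass {x} {y} ((xy , xy≁) , x∉ , y∉) with Eₖ-split xy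
    ... | inj₁ xy′ = inj₁ (xy′ , x∉ ∘ sound , y∉ ∘ sound) ◅ ε
    -- A common neighbour of xy outside D(e) gives a detour of two edges of E_m. If there is none,
    -- D(xy) lies in D(e) and equals it by size.
    ... | inj₂ xy′ with any? (λ w → Common? m x y w ×-dec ¬? (Common? m u v w))
    ...   | yes (w , (xw , yw) , w∉) =
      inj₁ (xw , x∉ ∘ sound , w∉ ∘ sound) ◅ inj₁ (Eₖ-sym yw , w∉ ∘ sound , y∉ ∘ sound) ◅ ε
    ...   | no ¬w = inj₂ ((xy′ , xy≁) , All.tabulate (proj₁ ∘ ds⊆) , All.tabulate (proj₂ ∘ ds⊆)) ◅ ε
      where
      inside : ∀ {w} → Common m x y w → Common m u v w
      inside {w} c with Common? m u v w
      ... | yes c′ = c′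
      ... | no ¬c′ = contradiction (w , c , ¬c′) ¬w
      ds⊆ : ∀ {w} → w ∈ ds → Common m x y w
      ds⊆ w∈ = Enumeration-⊆⇒⊇ (commonNbrs mat xy′) (commonNbrs mat e) inside (sound w∈)

    meet : ∀ {c x} → Complete c → Complete x → Star (Eₖ E lab m -ᵛ (_∈ ds)) c x → c ≡ x
    meet {c} {x} c-ds x-ds seg with c ≟ x
    ... | yes c≡x = c≡x
    ... | no  c≢x = contradiction seg (disconnected m clique size c-ds x-ds c≢x)

    -- `c` is the vertex reached by the retained edges of label m+1, and the last argument is the
    -- stretch of E_m edges since then, which `meet` contracts to a point.
    collapse : ∀ {x y} → Star Step x y → ∀ {c} → Complete c → Complete y →
               Star (Eₖ E lab m -ᵛ (_∈ ds)) c x → Star (π E lab (suc m) ∖[ u , v ]) c y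
    collapse ε c-ds y-ds seg with meet c-ds y-ds seg
    ... | refl = ε
    collapse (inj₁ s ◅ walk) c-ds y-ds seg = collapse walk c-ds y-ds (seg ◅◅ s ◅ ε)
    collapse (inj₂ (f , x-ds , z-ds) ◅ walk) c-ds y-ds seg with meet c-ds x-ds seg
    ... | refl = f ◅ collapse walk z-ds y-ds ε

-- Gluing

ML3-cong : ∀ {n} (E E′ : EdgeRel n) lab lab′ {m u v} →
           (∀ {w} → CommonNbr E lab m u v w → CommonNbr E′ lab′ m u v w) →
           (∀ {w} → CommonNbr E′ lab′ m u v w → CommonNbr E lab m u v w) →
           Fin m ↔ Σ (Fin n) (CommonNbr E lab m u v) → Fin m ↔ Σ (Fin n) (CommonNbr E′ lab′ m u v)
ML3-cong E E′ lab lab′ to from bij =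
  Σ-↔ (↔-id _) (mk↔ₛ′ to from (λ _ → CommonNbr-irrelevant E′ lab′ _ _ _ _ _ _)
                             (λ _ → CommonNbr-irrelevant E lab _ _ _ _ _ _)) ↔-∘ bij

-- The axioms see labels on edges only. This replaces the three given labelings by the glued one, so
-- that all pieces share one `lab`.
relabel : ∀ {n} {E : EdgeRel n} {lab lab′ : Fin n → Fin n → ℕ} →
          (∀ {u v} → T (E u v) → T (E v u)) →
          (∀ {u v} → T (E u v) → lab u v ≡ lab′ u v) → IsMATLabeling E lab → IsMATLabeling E lab′
relabel {E = E} {lab} {lab′} E-sym eq mat = record
  { labeling = λ u v e → let (1≤ , s) = labeling u v e in
      subst (1 ≤_) (eq e) 1≤ , trans (≡-sym (eq e)) (trans s (eq (E-sym e)))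
  ; ML1 = λ { k 1≤k (x , y , z , zs , uniq , linked) →
      ML1 k 1≤k (x , y , z , zs , uniq , Linked.map (λ (e , l) → e , trans (eq e) l) linked) }
  ; ML2 = λ k 1≤k u v walk low → ML2 k 1≤k u v (Star.map (λ (e , l) → e , trans (eq e) l) walk) (back low)
  ; ML3 = λ { (suc m) 1≤k u v (e , l) →
      ML3-cong E E lab lab′ (λ (p , q) → forth p , forth q) (λ (p , q) → back p , back q)
        (ML3 (suc m) 1≤k u v (e , trans (eq e) l)) }
  }
  where
  open IsMATLabeling mat
  forth : ∀ {k u v} → Eₖ E lab k u v → Eₖ E lab′ k u v
  forth (e , b) = e , subst (λ l → 1 ≤ l × l ≤ _) (eq e) b
  back : ∀ {k u v} → Eₖ E lab′ k u v → Eₖ E lab k u v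
  back (e , b) = e , subst (λ l → 1 ≤ l × l ≤ _) (≡-sym (eq e)) b

-- Induced subgraphs and the retraction of walks onto one side

module _ {n : ℕ} (G : SimpleGraph n) where

  adj-sym : ∀ {u v} → T (adj G u v) → T (adj G v u)
  adj-sym {u} {v} = subst T (SimpleGraph.sym G u v)

  adj-irrefl : ∀ {u} → ¬ T (adj G u u)
  adj-irrefl {u} = subst T (SimpleGraph.irrefl G u)

  induced⁺ : ∀ {X u v} → T (adj G u v) → T (X u) → T (X v) → T (induced G X u v)
  induced⁺ e xu xv = Equivalence.from T-∧ (e , Equivalence.from T-∧ (xu , xv))

  induced⁻ : ∀ {X u v} → T (induced G X u v) → T (adj G u v) × T (X u) × T (X v)
  induced⁻ e = let (e′ , x) = Equivalence.to T-∧ e in e′ , Equivalence.to T-∧ x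

  induced-sym : ∀ X {u v} → T (induced G X u v) → T (induced G X v u)
  induced-sym X e = let (e′ , xu , xv) = induced⁻ {X} e in induced⁺ {X} (adj-sym e′) xv xu

  induced-mono : ∀ X Y → (∀ {v} → T (X v) → T (Y v)) → ∀ {u v} → T (induced G X u v) → T (induced G Y u v)
  induced-mono X Y X⊆Y e = let (e′ , xu , xv) = induced⁻ {X} e in induced⁺ {Y} e′ (X⊆Y xu) (X⊆Y xv)

  -- ML3 for both labelings: the common neighbours inside X already number m.
  commonNbr-closed : ∀ X Y {lab} → (∀ {v} → T (X v) → T (Y v)) →
                     IsMATLabeling (induced G X) lab → IsMATLabeling (induced G Y) lab →
                     ∀ {m u v w} → T (X u) → T (X v) → π (induced G Y) lab (suc m) u v →
                     CommonNbr (induced G Y) lab m u v w → T (X w)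
  commonNbr-closed X Y {lab} X⊆Y matX matY {m} {u} {v} xu xv (e , l) c =
    proj₂ (proj₂ (induced⁻ {X} (proj₁ (proj₁
      (Enumeration-⊆⇒⊇ (commonNbrs matX (induced⁺ {X} (proj₁ (induced⁻ {Y} e)) xu xv , l))
                       (commonNbrs matY (e , l)) widen c)))))
    where
    widen : ∀ {w} → CommonNbr (induced G X) lab m u v w → CommonNbr (induced G Y) lab m u v w
    widen ((e₁ , b₁) , (e₂ , b₂)) = (induced-mono X Y X⊆Y e₁ , b₁) , (induced-mono X Y X⊆Y e₂ , b₂)

  -- Used twice, with A and B exchanged. The hypothesis `closed` is where the labeling of the
  -- overlap enters.
  module Retraction (A B : VSet n) (lab : Fin n → Fin n → ℕ)
    (edges : ∀ {u v} → T (adj G u v) → T (induced G A u v) ⊎ T (induced G B u v))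
    (clique : ∀ {u v} → u ≢ v → T (A u) → T (B u) → T (A v) → T (B v) → T (adj G u v))
    (matA : IsMATLabeling (induced G A) lab) (matB : IsMATLabeling (induced G B) lab)
    (closed : ∀ {m u v w} → T (A u) → T (A v) → π (induced G B) lab (suc m) u v →
              CommonNbr (induced G B) lab m u v w → T (A w))
    where

    private
      EA = induced G A
      EB = induced G B
      module A = MATGraph {E = EA} (induced-sym A) (λ e → adj-irrefl (proj₁ (induced⁻ {A} e))) matA
      module B = MATGraph {E = EB} (induced-sym B) (λ e → adj-irrefl (proj₁ (induced⁻ {B} e))) matB

    common-inside : ∀ {m u v w} → π EA lab (suc m) u v → CommonNbr (adj G) lab m u v w → T (A w)
    common-inside {w = w} (e , l) ((uw , _ , uw≤) , (vw , _ , vw≤)) with edges uw | edges vw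
    ... | inj₁ uw′ | _        = proj₂ (proj₂ (induced⁻ {A} uw′))
    ... | inj₂ _   | inj₁ vw′ = proj₂ (proj₂ (induced⁻ {A} vw′))
    -- Here `u` and `v` lie in A ∩ B, so uv is also an edge of G[B].
    ... | inj₂ uw′ | inj₂ vw′ =
      let (uv , au , av) = induced⁻ {A} e
          bu = proj₁ (proj₂ (induced⁻ {B} uw′))
          bv = proj₁ (proj₂ (induced⁻ {B} vw′))
          labeling = IsMATLabeling.labeling matB
      in closed au av (induced⁺ {B} uv bu bv , l)
           ((uw′ , proj₁ (labeling _ _ uw′) , uw≤) , (vw′ , proj₁ (labeling _ _ vw′) , vw≤))

    -- `Q` is a constraint carried along the walk: avoiding a given edge for ML1, vacuous for ML2.
    module _ {m : ℕ} (Q : Fin n → Fin n → Set) (Q? : ∀ x y → Dec (Q x y)) (Q-sym : ∀ {x y} → Q x y → Q y x) where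

      _⊓Q : (Fin n → Fin n → Set) → Fin n → Fin n → Set
      (R ⊓Q) x y = R x y × Q x y

      -- A step of an excursion from A. With `c` in A, only the last step can return to A.
      Outside : Fin n → Fin n → Fin n → Set
      Outside c x y = (π EB lab (suc m) ⊓Q) x y × ¬ T (A x) × (¬ T (A y) ⊎ y ≡ c)

      -- The ends lie in the clique A ∩ B, hence are equal or adjacent. ML2 excludes a label of xc
      -- below m+1, and `separation` excludes a larger one.
      shortcut : ∀ {x y c} → T (A x) → T (A c) → T (B c) →
                 (π EB lab (suc m) ⊓Q) x y → ¬ T (A y) → Star (Outside c) y c →
                 Star (π EA lab (suc m) ⊓Q) x c
      shortcut {x} {y} {c} ax ac bc step@(xy , _) y∉A walk with x ≟ c
      ... | yes refl = ε
      ... | no x≢c = replace (<-cmp (lab x c) (suc m))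
        where
        bx = proj₁ (proj₂ (induced⁻ {B} (proj₁ xy)))
        adj-xc = clique x≢c ax bx ac bc
        xc = induced⁺ {B} adj-xc bx bc
        lab-cx = B.lab-sym xc

        πwalk : Star (π EB lab (suc m) ⊓Q) x c
        πwalk = step ◅ Star.map proj₁ walk

        common⊆A : ∀ {m′ w} → lab x c ≡ suc m′ → CommonNbr EB lab m′ x c w → T (A w)
        common⊆A l = closed ax ac (xc , l)

        -- Edges of label m+1 differ from xc, whose label is larger, and vertices outside A miss
        -- D(xc), which lies in A.
        avoid : ∀ {m′ p q} → suc m < lab x c → lab x c ≡ suc m′ → ¬ CommonNbr EB lab m′ x c p →
                ¬ T (A q) ⊎ q ≡ c → π EB lab (suc m) p q → B.Avoiding m′ x c p q
        avoid {m′} {p} {q} l> l p∉ q-out pq@(e , lpq) = (pq∈ , pq≁) , p∉ , q∉ q-out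
          where
          pq∈ : Eₖ EB lab (suc m′) p q
          pq∈ = e , proj₁ (IsMATLabeling.labeling matB _ _ e)
                  , ≤-trans (≤-reflexive lpq) (≤-trans (<⇒≤ l>) (≤-reflexive l))
          pq≁ : ¬ SameEdge x c p q
          pq≁ (inj₁ (refl , refl)) = <⇒≢ l> (≡-sym lpq)
          pq≁ (inj₂ (refl , refl)) = <⇒≢ l> (trans (≡-sym lpq) lab-cx)
          q∉ : ¬ T (A q) ⊎ q ≡ c → ¬ CommonNbr EB lab m′ x c q
          q∉ (inj₁ q∉A) = q∉A ∘ common⊆A l
          q∉ (inj₂ refl) = B.¬Commonʳ

        replace : Tri (lab x c < suc m) (lab x c ≡ suc m) (suc m < lab x c) →
                  Star (π EA lab (suc m) ⊓Q) x c
        replace (tri< (s≤s l≤m) _ _) =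
          contradiction (xc , proj₁ (IsMATLabeling.labeling matB _ _ xc) , l≤m) (B.ML2′ (Star.map proj₁ πwalk))
        replace (tri≈ _ l≡ _) with Q? x c
        ... | yes q = ((induced⁺ {A} adj-xc ax ac , l≡) , q) ◅ ε
        -- Every edge of the excursion satisfies `Q`, so none is xc, and the excursion reconnects
        -- the ends of xc within π_(m+1).
        ... | no ¬q = ⊥-elim (B.reconnected-⊥ (xc , l≡) (Star.map
                (λ (pq , q) → pq , λ { (inj₁ (refl , refl)) → ¬q q ; (inj₂ (refl , refl)) → ¬q (Q-sym q) }) πwalk))
        replace (tri> _ _ l>) = contra (lab x c) refl
          where
          contra : ∀ l → lab x c ≡ l → Star (π EA lab (suc m) ⊓Q) x c
          contra zero l = contradiction (subst (suc m <_) l l>) λ ()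
          contra (suc m′) l = ⊥-elim (B.separation m′ (xc , l)
            (avoid l> l B.¬Commonˡ (inj₁ y∉A) xy
             ◅ Star.map (λ ((pq , _) , p∉A , q-out) → avoid l> l (p∉A ∘ common⊆A l) q-out pq) walk))

      -- Invariant for a walk built backwards from its end: a start outside A is in mid-excursion,
      -- which is kept up to its return vertex `c` until the edge leaving A is met.
      Retract : Fin n → Fin n → Set
      Retract x v = (T (A x) → Star (π EA lab (suc m) ⊓Q) x v)
                  × (¬ T (A x) → ∃ λ c → T (A c) × T (B c) × Star (Outside c) x c × Star (π EA lab (suc m) ⊓Q) c v)

      retract-step : ∀ {x y v} → (π (adj G) lab (suc m) ⊓Q) x y → Retract y v → Retract x v
      retract-step {x} {y} ((e , l) , q) (inA , outA) with edges e
      ... | inj₁ eA = let (_ , ax , ay) = induced⁻ {A} eA in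
        (λ _ → ((eA , l) , q) ◅ inA ay) , contradiction ax
      ... | inj₂ eB with T? (A y) | induced⁻ {B} eB
      ...   | yes ay | _ , _ , by =
        (λ ax → ((induced⁺ {A} e ax ay , l) , q) ◅ inA ay) ,
        (λ x∉A → y , ay , by , (((eB , l) , q) , x∉A , inj₂ refl) ◅ ε , inA ay)
      ...   | no y∉A | _ = let (c , ac , bc , out , back) = outA y∉A in
        (λ ax → shortcut ax ac bc ((eB , l) , q) y∉A out ◅◅ back) ,
        (λ x∉A → c , ac , bc , (((eB , l) , q) , x∉A , inj₁ y∉A) ◅ out , back)

      retract : ∀ {u v} → T (A v) → Star (π (adj G) lab (suc m) ⊓Q) u v → Retract u v
      retract av ε = (λ _ → ε) , contradiction av
      retract av (s ◅ walk) = retract-step s (retract av walk)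

    -- Retracting with `Q` forbidding uv gives a walk in G[A] that still avoids uv, against ML1
    -- there.
    forestᴬ : ∀ {m u v} → π EA lab (suc m) u v → ¬ Star (π (adj G) lab (suc m) ∖[ u , v ]) u v
    forestᴬ {m} {u} {v} e walk =
      let (_ , au , av) = induced⁻ {A} (proj₁ e) in
      A.reconnected-⊥ e (proj₁ (retract (λ x y → ¬ SameEdge u v x y) (λ x y → ¬? (sameEdge? x y)) (_∘ flipEdge) av walk) au)
      where
      sameEdge? : ∀ x y → Dec (SameEdge u v x y)
      sameEdge? x y = (x ≟ u ×-dec y ≟ v) ⊎-dec (x ≟ v ×-dec y ≟ u)
      flipEdge : ∀ {x y} → SameEdge u v y x → SameEdge u v x y
      flipEdge (inj₁ (p , q)) = inj₂ (q , p)
      flipEdge (inj₂ (p , q)) = inj₁ (q , p)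

    closureᴬ : ∀ {m u v} → Star (π (adj G) lab (suc m)) u v → ¬ Eₖ EA lab m u v
    closureᴬ walk low =
      let (_ , au , av) = induced⁻ {A} (proj₁ low) in
      A.ML2′ (Star.map proj₁ (proj₁ (retract (λ _ _ → ⊤) (λ _ _ → yes tt) _ av (Star.map (_, tt) walk)) au)) low

    -- By `common-inside`, passing from G[A] to G adds no common neighbours.
    countᴬ : ∀ {m u v} → π EA lab (suc m) u v → Fin m ↔ Σ (Fin n) (CommonNbr (adj G) lab m u v)
    countᴬ {m} {u} {v} e = ML3-cong EA (adj G) lab lab widen restrict (IsMATLabeling.ML3 matA _ (s≤s z≤n) _ _ e)
      where
      widen : ∀ {w} → CommonNbr EA lab m u v w → CommonNbr (adj G) lab m u v w
      widen ((uw , b) , (vw , b′)) = (proj₁ (induced⁻ {A} uw) , b) , (proj₁ (induced⁻ {A} vw) , b′)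
      restrict : ∀ {w} → CommonNbr (adj G) lab m u v w → CommonNbr EA lab m u v w
      restrict c@((uw , b) , (vw , b′)) =
        let (_ , au , av) = induced⁻ {A} (proj₁ e)
            aw = common-inside e c
        in (induced⁺ {A} uw au aw , b) , (induced⁺ {A} vw av aw , b′)

-- The glued labeling

glue-A : ∀ {n} (A : VSet n) labA labB {u v} → T (A u ∧ A v) → labA u v ≡ glue A labA labB u v
glue-A A labA labB {u} {v} a with A u ∧ A v
... | true = refl

glue-B : ∀ {n} (A : VSet n) labA labB {u v} → (T (A u ∧ A v) → labB u v ≡ labA u v) →
         labB u v ≡ glue A labA labB u v
glue-B A labA labB {u} {v} eq with A u ∧ A v
... | true  = eq tt
... | false = refl

theorem5p8 : ∀ {n} (G : SimpleGraph n) (A B : VSet n)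
    → (∀ v → T (A v ∨ B v))
    → (∀ u v → T (adj G u v) → T (induced G A u v ∨ induced G B u v))
    → (∀ u v → u ≢ v → T ((A ∩V B) u) → T ((A ∩V B) v) → T (adj G u v))
    → (labA labB labAB : Fin n → Fin n → ℕ)
    → IsMATLabeling (induced G A) labA
    → IsMATLabeling (induced G B) labB
    → IsMATLabeling (induced G (A ∩V B)) labAB
    → (∀ u v → T (induced G (A ∩V B) u v) → labA u v ≡ labAB u v)
    → (∀ u v → T (induced G (A ∩V B) u v) → labB u v ≡ labAB u v)
    → IsMATLabeling (adj G) (glue A labA labB)
theorem5p8 {n} G A B _ cover clique labA labB labAB matA₀ matB₀ matK₀ eqA eqB = record
  { labeling = λ u v e → [ IsMATLabeling.labeling matA u v , IsMATLabeling.labeling matB u v ]′ (edges e)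
  ; ML1 = λ { (suc m) _ cycle → ML1 (cycle⇒reconnected cycle) }
  ; ML2 = λ { (suc m) _ u v walk (e , b) →
      [ (λ eA → InA.closureᴬ walk (eA , b)) , (λ eB → InB.closureᴬ walk (eB , b)) ]′ (edges e) }
  ; ML3 = λ { (suc m) _ u v (e , l) →
      [ (λ eA → InA.countᴬ (eA , l)) , (λ eB → InB.countᴬ (eB , l)) ]′ (edges e) }
  }
  where
  lab = glue A labA labB
  K = A ∩V B

  K⁺ : ∀ {v} → T (A v) → T (B v) → T (K v)
  K⁺ a b = Equivalence.from T-∧ (a , b)

  K⊆A : ∀ {v} → T (K v) → T (A v)
  K⊆A = proj₁ ∘ Equivalence.to T-∧

  K⊆B : ∀ {v} → T (K v) → T (B v)
  K⊆B {v} = proj₂ ∘ Equivalence.to (T-∧ {A v})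

  edges : ∀ {u v} → T (adj G u v) → T (induced G A u v) ⊎ T (induced G B u v)
  edges e = Equivalence.to T-∨ (cover _ _ e)

  labA≡ : ∀ {u v} → T (induced G A u v) → labA u v ≡ lab u v
  labA≡ e = glue-A A labA labB (proj₂ (Equivalence.to (T-∧ {adj G _ _}) e))

  labB≡ : ∀ {u v} → T (induced G B u v) → labB u v ≡ lab u v
  labB≡ {u} {v} e = glue-B A labA labB λ a →
    let (e′ , bu , bv) = induced⁻ G {B} e
        (au , av) = Equivalence.to T-∧ a
        eK = induced⁺ G {K} e′ (K⁺ au bu) (K⁺ av bv)
    in trans (eqB u v eK) (≡-sym (eqA u v eK))

  matA : IsMATLabeling (induced G A) lab
  matA = relabel (induced-sym G A) labA≡ matA₀

  matB : IsMATLabeling (induced G B) lab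
  matB = relabel (induced-sym G B) labB≡ matB₀

  matK : IsMATLabeling (induced G K) lab
  matK = relabel (induced-sym G K)
    (λ e → trans (≡-sym (eqA _ _ e)) (labA≡ (induced-mono G K A K⊆A e))) matK₀

  closedA : ∀ {m u v w} → T (B u) → T (B v) → π (induced G A) lab (suc m) u v →
            CommonNbr (induced G A) lab m u v w → T (B w)
  closedA bu bv e c =
    let (_ , au , av) = induced⁻ G {A} (proj₁ e) in
    K⊆B (commonNbr-closed G K A K⊆A matK matA (K⁺ au bu) (K⁺ av bv) e c)

  closedB : ∀ {m u v w} → T (A u) → T (A v) → π (induced G B) lab (suc m) u v →
            CommonNbr (induced G B) lab m u v w → T (A w)
  closedB au av e c =
    let (_ , bu , bv) = induced⁻ G {B} (proj₁ e) in
    K⊆A (commonNbr-closed G K B K⊆B matK matB (K⁺ au bu) (K⁺ av bv) e c)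

  module InA = Retraction G A B lab edges
    (λ u≢v au bu av bv → clique _ _ u≢v (K⁺ au bu) (K⁺ av bv)) matA matB closedB
  module InB = Retraction G B A lab (swap ∘ edges)
    (λ u≢v bu au bv av → clique _ _ u≢v (K⁺ au bu) (K⁺ av bv)) matB matA closedA

  ML1 : ∀ {m} → ¬ (∃ λ x → ∃ λ y → π (adj G) lab (suc m) x y × Star (π (adj G) lab (suc m) ∖[ y , x ]) y x)
  -- The edge is reversed to match the walk, which runs from `y` to `x`.
  ML1 (x , y , (e , l) , walk) with edges (adj-sym G e)
  ... | inj₁ eA = InA.forestᴬ (eA , trans (≡-sym (proj₂ (IsMATLabeling.labeling matA x y (induced-sym G A eA)))) l) walk
  ... | inj₂ eB = InB.forestᴬ (eB , trans (≡-sym (proj₂ (IsMATLabeling.labeling matB x y (induced-sym G B eB)))) l) walk
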